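{- Let $X,Y$ be objects of $\mathsf{WLTS}$. If $R\subseteq X\times Y$ is a weak bisimulation from $X$ to $Y$, then $$\widehat{R}=\{X\xleftarrow{x}Jv\xrightarrow{y}Y \mid v\in V,\ (\mathrm{end}(x),\mathrm{end}(y))\in R\}$$ is a path bisimulation from $X$ to $Y$. If $R$ is a path bisimulation from $X$ to $Y$, then $$\check{R}=\{(\mathrm{end}(x),\mathrm{end}(y)) \mid (X\xleftarrow{x}Jv\xrightarrow{y}Y)\in R\}$$ is a weak bisimulation from $X$ to $Y$.
   Context: Fix a set $A$ of labels with a distinguished element $\tau$. Objects of $\mathsf{WLTS}$ are labelled transition systems: a set $X$, a relation $\to\,\subseteq X\times A\times X$ (written $x\xrightarrow{a}x'$), and an initial state $i_X\in X$. Morphisms $f\colon X\to Y$ are functions with $f(i_X)=i_Y$ such that $x\xrightarrow{a}x'$ implies $f(x)\xrightarrow{a}f(x')$, or $a=\tau$ and $f(x)=f(x')$. A weak bisimulation from $X$ to $Y$ is $R\subseteq X\times Y$ with $(i_X,i_Y)\in R$ such that for $(x,y)\in R$: if $x\xrightarrow{\tau}x'$ there is $y'$ with $(x',y')\in R$ and $y\xrightarrow{\tau}{}^{*}y'$; if $x\xrightarrow{a}x'$ with $a\ne\tau$ there is $y'$ with $(x',y')\in R$ and $y\xrightarrow{\tau}{}^{*}\xrightarrow{a}\xrightarrow{\tau}{}^{*}y'$; and symmetrically for transitions of $y$. ($\xrightarrow{\tau}{}^{*}$ is the reflexive transitive closure of $\xrightarrow{\tau}$.) Path shapes. $V$ is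 the set of sequences $v=n_1,a_1,n_2,\dots,n_k,a_k,n_{k+1}$ with $k\ge0$, $a_i\in A\setminus\{\tau\}$, $n_i\in\mathbb{N}$. $Jv$ is the linear LTS with states $(i,j)$, $1\le j\le k+1$, $0\le i\le n_j$, initial state $(0,1)$, transitions $(i,j)\xrightarrow{\tau}(i+1,j)$ for $i<n_j$ and $(n_j,j)\xrightarrow{a_j}(0,j+1)$ for $j\le k$. For $x\colon Jv\to X$, $\mathrm{end}(x)=x(n_{k+1},k+1)$. The element $0\in V$ is the sequence with $k=0$, $n_1=0$; $J0$ is initial in $\mathsf{WLTS}$. Graph $\mathbb{E}$ on $V$: for $n_{k+1}\le n'_{k+1}$, a unique edge $e_\tau$ from $n_1,a_1,\dots,a_k,n_{k+1}$ to $n_1,a_1,\dots,a_k,n'_{k+1}$, and for each $a\in A\setminus\{\tau\}$ and $n_{k+2}\in\mathbb{N}$ a unique edge $e_a$ from $n_1,a_1,\dots,a_k,n_{k+1}$ to $n_1,a_1,\dots,a_k,n'_{k+1},a,n_{k+2}$. $J_{\mathbb{E}}$ sends an edge to the inclusion $(i,j)\mapsto(i,j)$. As category of extensions one takes the free category $\mathrm{Free}(\mathbb{E})$ with the induced functor, still denoted $J_{\mathbb{E}}$. Category $\mathbb{S}$ on $V$: morphisms from $n_1,a_1,\dots,a_k,n_{k+1}$ to $n'_1,a_1,\dots,a_k,n'_{k+1}$ (same letters, $n_i\ge n'_i$) are tuples $s=(s_1,\dots,s_{k+1})$ of monotone surjections $s_j\colon\{0,\dots,n_j\}\to\{0,\dots,n'_j\}$;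 $J_{\mathbb{S}}(s)(i,j)=(s_j(i),j)$. A path simulation from $X$ to $Y$ is a set $R$ of spans $X\xleftarrow{x}Jv\xrightarrow{y}Y$ in $\mathsf{WLTS}$ such that: (initial condition) $X\leftarrow J0\to Y$ is in $R$; (forward closure) for all $(X\xleftarrow{x}Jv\xrightarrow{y}Y)\in R$, $e\colon v\to w$ in $\mathrm{Free}(\mathbb{E})$ and $x'\colon Jw\to X$ with $x=x'\circ J_{\mathbb{E}}e$ there are $e'\colon v\to u$ in $\mathrm{Free}(\mathbb{E})$, $s\colon u\to w$ in $\mathbb{S}$, $y'\colon Ju\to Y$ with $J_{\mathbb{E}}e=J_{\mathbb{S}}s\circ J_{\mathbb{E}}e'$, $y=y'\circ J_{\mathbb{E}}e'$ and $(X\xleftarrow{x'\circ J_{\mathbb{S}}s}Ju\xrightarrow{y'}Y)\in R$. $R$ is a path bisimulation from $X$ to $Y$ if $R$ is a path simulation from $X$ to $Y$ and the set $R^\dagger$ of reversed spans is a path simulation from $Y$ to $X$. -}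

module Defs where

open import Level using (Level; _⊔_; suc)
open import Data.Nat.Base as ℕ using (ℕ)
import Data.Nat.Properties as ℕ
open import Data.Fin.Base as Fin using (Fin; zero; toℕ; fromℕ; inject≤)
import Data.Fin.Properties as Fin
open import Data.Empty using (⊥; ⊥-elim)
open import Data.Product.Base using (Σ-syntax; ∃-syntax; _×_; _,_; proj₁; proj₂)
open import Data.Refinement.Base using (Refinement-syntax; value)
open import Data.Sum.Base using (_⊎_; inj₁; inj₂)
open import Function.Base using (flip)
open import Function.Definitions using (Surjective)
open import Relation.Binary.Core using (REL; _Preserves_⟶_)
open import Relation.Binary.Construct.Closure.ReflexiveTransitive using (Star; ε; _◅_)
open import Relation.Binary.PropositionalEquality.Core
  using (_≡_; _≢_; refl; sym; trans; cong; subst; subst₂)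
open import Relation.Binary.Definitions using (tri<; tri≈; tri>)

module WLTS {a} (A : Set a) (τ : A) where

  private variable
    x y z r s t ρ : Level

  record LTS x r : Set (a ⊔ suc (x ⊔ r)) where
    field
      Carrier : Set x
      _⟶[_]_  : Carrier → A → Carrier → Set r
      init    : Carrier

  open LTS public using (Carrier; init)

  record Hom (X : LTS x r) (Y : LTS y s) : Set (a ⊔ x ⊔ r ⊔ y ⊔ s) where
    private
      module X = LTS X
      module Y = LTS Y
    field
      fun       : X.Carrier → Y.Carrier
      fun-init  : fun X.init ≡ Y.init
      fun-trans : ∀ {p b q} → p X.⟶[ b ] q →
                  (fun p Y.⟶[ b ] fun q) ⊎ (b ≡ τ × fun p ≡ fun q)

  open Hom public

  -- Morphisms are functions with a property, so their equality is pointwise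
  -- equality of the underlying functions.
  infix 4 _≈_
  _≈_ : {X : LTS x r} {Y : LTS y s} → Hom X Y → Hom X Y → Set (x ⊔ y)
  f ≈ g = ∀ p → fun f p ≡ fun g p

  idHom : {X : LTS x r} → Hom X X
  idHom = record { fun = λ p → p ; fun-init = refl ; fun-trans = inj₁ }

  infixr 9 _∘_
  _∘_ : {X : LTS x r} {Y : LTS y s} {Z : LTS z t} → Hom Y Z → Hom X Y → Hom X Z
  _∘_ {X = X} {Z = Z} g f = record
    { fun       = λ p → fun g (fun f p)
    ; fun-init  = trans (cong (fun g) (fun-init f)) (fun-init g)
    ; fun-trans = pres
    }
    where
    module X = LTS X
    module Z = LTS Z
    pres : ∀ {p b q} → p X.⟶[ b ] q →
           (fun g (fun f p) Z.⟶[ b ] fun g (fun f q)) ⊎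
           (b ≡ τ × fun g (fun f p) ≡ fun g (fun f q))
    pres step with fun-trans f step
    ... | inj₁ step′        = fun-trans g step′
    ... | inj₂ (b≡τ , p≡q) = inj₂ (b≡τ , cong (fun g) p≡q)

  module _ (X : LTS x r) where
    open LTS X using (_⟶[_]_)

    Silent : Carrier X → Carrier X → Set (x ⊔ r)
    Silent = Star (λ p q → p ⟶[ τ ] q)

    Weak : A → Carrier X → Carrier X → Set (x ⊔ r)
    Weak b p q = ∃[ p′ ] ∃[ q′ ] Silent p p′ × (p′ ⟶[ b ] q′) × Silent q′ q

  record WeakTransfer (X : LTS x r) (Y : LTS y s)
                      (R : REL (Carrier X) (Carrier Y) ρ) :
                      Set (a ⊔ x ⊔ r ⊔ y ⊔ s ⊔ ρ) where
    open LTS X using (_⟶[_]_)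
    field
      silent  : ∀ {p q p′} → R p q → p ⟶[ τ ] p′ →
                ∃[ q′ ] R p′ q′ × Silent Y q q′
      visible : ∀ {p q b p′} → R p q → b ≢ τ → p ⟶[ b ] p′ →
                ∃[ q′ ] R p′ q′ × Weak Y b q q′

  record IsWeakBisimulation (X : LTS x r) (Y : LTS y s)
                            (R : REL (Carrier X) (Carrier Y) ρ) :
                            Set (a ⊔ x ⊔ r ⊔ y ⊔ s ⊔ ρ) where
    field
      initial : R (init X) (init Y)
      forth   : WeakTransfer X Y R
      back    : WeakTransfer Y X (flip R)

  Visible : Set a
  Visible = [ b ∈ A ∣ b ≢ τ ]

  -- The initial segment n₁,a₁,…,nₖ,aₖ of a path shape, as a snoc list.
  data Prefix : Set a where
    []   : Prefix
    _▷_·_ : Prefix → ℕ → Visible → Prefix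

  infixl 5 _▷_·_

  -- (π , n) is the sequence n₁,a₁,…,nₖ,aₖ,n with π = n₁,a₁,…,nₖ,aₖ.
  V : Set a
  V = Prefix × ℕ

  𝟎 : V
  𝟎 = [] , 0

  private variable
    π π′ : Prefix
    m n m′ n′ : ℕ
    b : Visible
    u v w : V

  -- The states (i,j) of Jv, with j counted from the right: `last i` is
  -- (i,k+1), and `prev` re-indexes a state of the sequence without its last
  -- letter and number.  `coords` recovers the pair.
  data State : V → Set a where
    last : Fin (ℕ.suc n) → State (π , n)
    prev : State (π , m) → State (π ▷ m · b , n)

  blocks : Prefix → ℕ
  blocks []          = 0
  blocks (π ▷ _ · _) = ℕ.suc (blocks π)

  coords : State v → ℕ × ℕ
  coords (last {π = π} i) = toℕ i , ℕ.suc (blocks π)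
  coords (prev p)         = coords p

  data Step : State v → A → State v → Set a where
    τ-step : {i j : Fin (ℕ.suc n)} → toℕ j ≡ ℕ.suc (toℕ i) →
             Step {π , n} (last i) τ (last j)
    a-step : Step {π ▷ m · b , n} (prev (last (fromℕ m))) (value b) (last zero)
    prev   : ∀ {c} {p q : State (π , m)} → Step p c q →
             Step {π ▷ m · b , n} (prev p) c (prev q)

  first : ∀ π n → State (π , n)
  first []          n = last zero
  first (π ▷ m · b) n = prev (first π m)

  final : ∀ v → State v
  final (π , n) = last (fromℕ n)

  J : V → LTS a a
  J (π , n) = record { Carrier = State (π , n) ; _⟶[_]_ = Step ; init = first π n }

  end : {X : LTS x r} → Hom (J v) X → Carrier X
  end {v = v} f = fun f (final v)

  -- J𝟎 has one state, so this is the only morphism out of it (up to _≈_).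
  ¡ : {X : LTS x r} → Hom (J 𝟎) X
  ¡ {X = X} = record { fun = λ _ → init X ; fun-init = refl ; fun-trans = pres }
    where
    pres : ∀ {p c q} → Step {𝟎} p c q →
           LTS._⟶[_]_ X (init X) c (init X) ⊎ (c ≡ τ × init X ≡ init X)
    pres (τ-step _) = inj₂ (refl , refl)

  data 𝔼 : V → V → Set a where
    e-τ : n ℕ.≤ n′ → 𝔼 (π , n) (π , n′)
    e-a : n ℕ.≤ n′ → (b : Visible) (m : ℕ) → 𝔼 (π , n) (π ▷ n′ · b , m)

  include : n ℕ.≤ n′ → State (π , n) → State (π , n′)
  include n≤n′ (last i) = last (inject≤ i (ℕ.s≤s n≤n′))
  include n≤n′ (prev p) = prev p

  include-step : (n≤n′ : n ℕ.≤ n′) → ∀ {c} {p q : State (π , n)} →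
                 Step p c q → Step (include n≤n′ p) c (include n≤n′ q)
  include-step n≤n′ (τ-step {i = i} {j} eq) = τ-step
    (trans (Fin.toℕ-inject≤ j (ℕ.s≤s n≤n′))
           (trans eq (cong ℕ.suc (sym (Fin.toℕ-inject≤ i (ℕ.s≤s n≤n′))))))
  include-step n≤n′ a-step   = a-step
  include-step n≤n′ (prev s) = prev s

  include-first : (n≤n′ : n ℕ.≤ n′) → include n≤n′ (first π n) ≡ first π n′
  include-first {π = []}        n≤n′ = refl
  include-first {π = _ ▷ _ · _} n≤n′ = refl

  J-edge : 𝔼 v w → Hom (J v) (J w)
  J-edge (e-τ n≤n′) = record
    { fun       = include n≤n′
    ; fun-init  = include-first n≤n′
    ; fun-trans = λ s → inj₁ (include-step n≤n′ s)
    }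
  J-edge (e-a n≤n′ b m) = record
    { fun       = λ p → prev (include n≤n′ p)
    ; fun-init  = cong prev (include-first n≤n′)
    ; fun-trans = λ s → inj₁ (prev (include-step n≤n′ s))
    }

  -- J-edge e is the inclusion (i,j) ↦ (i,j).
  J-edge-coords : (e : 𝔼 v w) (p : State v) → coords (fun (J-edge e) p) ≡ coords p
  J-edge-coords (e-τ n≤n′)     (last i) = cong (_, _) (Fin.toℕ-inject≤ i (ℕ.s≤s n≤n′))
  J-edge-coords (e-τ n≤n′)     (prev p) = refl
  J-edge-coords (e-a n≤n′ b m) (last i) = cong (_, _) (Fin.toℕ-inject≤ i (ℕ.s≤s n≤n′))
  J-edge-coords (e-a n≤n′ b m) (prev p) = refl

  -- Morphisms of the free category on 𝔼.
  Free𝔼 : V → V → Set a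
  Free𝔼 = Star 𝔼

  J𝔼 : Free𝔼 v w → Hom (J v) (J w)
  J𝔼 ε        = idHom
  J𝔼 (e ◅ es) = J𝔼 es ∘ J-edge e

  record MonotoneSurjection (n n′ : ℕ) : Set where
    field
      to         : Fin (ℕ.suc n) → Fin (ℕ.suc n′)
      monotone   : to Preserves Fin._≤_ ⟶ Fin._≤_
      surjective : Surjective _≡_ _≡_ to

  open MonotoneSurjection public

  -- The inequalities nᵢ ≥ nᵢ′ follow from the existence of the surjections.
  data 𝕊 : V → V → Set a where
    [_] : MonotoneSurjection n n′ → 𝕊 ([] , n) ([] , n′)
    _▷_ : 𝕊 (π , m) (π′ , m′) → MonotoneSurjection n n′ →
          𝕊 (π ▷ m · b , n) (π′ ▷ m′ · b , n′)

  infixl 5 _▷_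

  collapse : 𝕊 v w → State v → State w
  collapse [ σ ]   (last i) = last (to σ i)
  collapse (s ▷ σ) (last i) = last (to σ i)
  collapse (s ▷ σ) (prev p) = prev (collapse s p)

  to-zero : (σ : MonotoneSurjection n n′) → to σ zero ≡ zero
  to-zero σ with surjective σ zero
  ... | i , hit = Fin.toℕ-injective (ℕ.n≤0⇒n≡0
    (subst (λ k → toℕ (to σ zero) ℕ.≤ toℕ k) (hit refl) (monotone σ {zero} {i} ℕ.z≤n)))

  to-top : (σ : MonotoneSurjection n n′) → to σ (fromℕ n) ≡ fromℕ n′
  to-top {n} {n′} σ with surjective σ (fromℕ n′)
  ... | i , hit = Fin.≤-antisym (Fin.≤fromℕ (to σ (fromℕ n)))
    (subst (Fin._≤ to σ (fromℕ n)) (hit refl) (monotone σ (Fin.≤fromℕ i)))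

  to-suc : (σ : MonotoneSurjection n n′) {i j : Fin (ℕ.suc n)} →
           toℕ j ≡ ℕ.suc (toℕ i) →
           toℕ (to σ j) ≡ ℕ.suc (toℕ (to σ i)) ⊎ to σ i ≡ to σ j
  to-suc σ {i} {j} eq with ℕ.<-cmp (ℕ.suc (toℕ (to σ i))) (toℕ (to σ j))
  ... | tri≈ _ e _          = inj₁ (sym e)
  ... | tri> _ _ (ℕ.s≤s gt) = inj₂ (Fin.≤-antisym (monotone σ i≤j) gt)
    where
    i≤j : i Fin.≤ j
    i≤j = ℕ.≤-trans (ℕ.n≤1+n _) (ℕ.≤-reflexive (sym eq))
  ... | tri< lt _ _         = ⊥-elim (between (ℕ.≤-<-connex (toℕ l) (toℕ i)))
    where
    k<  = ℕ.<-trans lt (Fin.toℕ<n (to σ j))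
    l   = proj₁ (surjective σ (Fin.fromℕ< k<))
    hit : toℕ (to σ l) ≡ ℕ.suc (toℕ (to σ i))
    hit = trans (cong toℕ (proj₂ (surjective σ (Fin.fromℕ< k<)) refl)) (Fin.toℕ-fromℕ< k<)
    between : toℕ l ℕ.≤ toℕ i ⊎ toℕ i ℕ.< toℕ l → ⊥
    between (inj₁ l≤i) = ℕ.1+n≰n (subst (ℕ._≤ toℕ (to σ i)) hit (monotone σ l≤i))
    between (inj₂ i<l) = ℕ.<⇒≱ lt (subst (toℕ (to σ j) ℕ.≤_) hit
      (monotone σ (subst (ℕ._≤ toℕ l) (sym eq) i<l)))

  collapse-first : (s : 𝕊 v w) → collapse s (init (J v)) ≡ init (J w)
  collapse-first [ σ ]   = cong last (to-zero σ)
  collapse-first (s ▷ σ) = cong prev (collapse-first s)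

  collapse-final : (s : 𝕊 v w) → collapse s (final v) ≡ final w
  collapse-final [ σ ]   = cong last (to-top σ)
  collapse-final (s ▷ σ) = cong last (to-top σ)

  collapse-step : (s : 𝕊 v w) → ∀ {c p q} → Step p c q →
                  Step (collapse s p) c (collapse s q) ⊎
                  (c ≡ τ × collapse s p ≡ collapse s q)
  collapse-step [ σ ] (τ-step eq) with to-suc σ eq
  ... | inj₁ up   = inj₁ (τ-step up)
  ... | inj₂ stay = inj₂ (refl , cong last stay)
  collapse-step (s ▷ σ) (τ-step eq) with to-suc σ eq
  ... | inj₁ up   = inj₁ (τ-step up)
  ... | inj₂ stay = inj₂ (refl , cong last stay)
  collapse-step (s ▷ σ) a-step =
    inj₁ (subst₂ (λ p q → Step (prev p) _ (last q))
                 (sym (collapse-final s)) (sym (to-zero σ)) a-step)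
  collapse-step (s ▷ σ) (prev step) with collapse-step s step
  ... | inj₁ step′     = inj₁ (prev step′)
  ... | inj₂ (c≡τ , e) = inj₂ (c≡τ , cong prev e)

  J𝕊 : 𝕊 v w → Hom (J v) (J w)
  J𝕊 s = record
    { fun       = collapse s
    ; fun-init  = collapse-first s
    ; fun-trans = collapse-step s
    }

  -- A set of spans X ← Jv → Y; being a set, it respects equality of morphisms.
  record SpanSet (X : LTS x r) (Y : LTS y s) ρ : Set (a ⊔ x ⊔ r ⊔ y ⊔ s ⊔ suc ρ) where
    field
      Span : ∀ {v} → Hom (J v) X → Hom (J v) Y → Set ρ
      resp : ∀ {v} {f f′ : Hom (J v) X} {g g′ : Hom (J v) Y} →
             f ≈ f′ → g ≈ g′ → Span f g → Span f′ g′

  open SpanSet public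

  infix 8 _†
  _† : {X : LTS x r} {Y : LTS y s} → SpanSet X Y ρ → SpanSet Y X ρ
  R † = record
    { Span = λ g f → Span R f g
    ; resp = λ g≈g′ f≈f′ → resp R f≈f′ g≈g′
    }

  record IsPathSimulation (X : LTS x r) (Y : LTS y s) (R : SpanSet X Y ρ) :
                          Set (a ⊔ x ⊔ r ⊔ y ⊔ s ⊔ ρ) where
    field
      initial : Span R ¡ ¡
      forward : ∀ {v w} {f : Hom (J v) X} {g : Hom (J v) Y} → Span R f g →
                (e : Free𝔼 v w) (f′ : Hom (J w) X) → f ≈ f′ ∘ J𝔼 e →
                ∃[ u ] Σ[ e′ ∈ Free𝔼 v u ] Σ[ s ∈ 𝕊 u w ] Σ[ g′ ∈ Hom (J u) Y ]
                  J𝔼 e ≈ J𝕊 s ∘ J𝔼 e′ × g ≈ g′ ∘ J𝔼 e′ × Span R (f′ ∘ J𝕊 s) g′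

  record IsPathBisimulation (X : LTS x r) (Y : LTS y s) (R : SpanSet X Y ρ) :
                            Set (a ⊔ x ⊔ r ⊔ y ⊔ s ⊔ ρ) where
    field
      forth : IsPathSimulation X Y R
      back  : IsPathSimulation Y X (R †)

  toSpans : (X : LTS x r) (Y : LTS y s) → REL (Carrier X) (Carrier Y) ρ → SpanSet X Y ρ
  toSpans X Y R = record
    { Span = λ f g → R (end f) (end g)
    ; resp = λ f≈f′ g≈g′ → subst₂ R (f≈f′ _) (g≈g′ _)
    }

  fromSpans : (X : LTS x r) (Y : LTS y s) → SpanSet X Y ρ →
              REL (Carrier X) (Carrier Y) (a ⊔ x ⊔ r ⊔ y ⊔ s ⊔ ρ)
  fromSpans X Y R p q =
    ∃[ v ] Σ[ f ∈ Hom (J v) X ] Σ[ g ∈ Hom (J v) Y ]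
      Span R f g × p ≡ end f × q ≡ end g

-- A path simulation may stretch shapes: if x′ extends x by a τ-step that Y
-- answers with ℓ silent steps, then Y's path is extended by 1 + ℓ positions (the
-- first one idle) and the surjection onto the shape of x′ collapses the surplus
-- ones. The idle position also covers ℓ = 0. As the morphisms of Free𝔼 are
-- generated by single τ-steps and letters, answering those suffices, and the
-- answers compose. Conversely, given an answer e′ : v → u, s : u → w to such an
-- extension v → w, s forces u to have as many blocks as w, while e′ preserves
-- coordinates; so the state of Ju reached from the end of Jv lies in the last
-- block, or in the last but one if a letter was added, and the rest of Ju is a
-- silent or weak transition.
module Submission where

open import Defs
open import Level using (Level; _⊔_)
open import Data.Nat.Base as ℕ using (ℕ; suc)
import Data.Nat.Properties as ℕ
open import Data.Fin.Base as Fin using (Fin; zero; suc; toℕ; fromℕ; inject₁; inject≤)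
import Data.Fin.Properties as Fin
open import Data.Empty using (⊥-elim; ⊥-elim-irr)
open import Data.Fin.Relation.Unary.Top using (view; ‵fromℕ; ‵inject₁)
open import Data.Irrelevant using ([_])
open import Data.Product.Base using (Σ-syntax; ∃-syntax; _×_; _,_; proj₁; proj₂)
open import Data.Refinement.Base using (value; _,_)
open import Data.Sum.Base using (_⊎_; inj₁; inj₂)
open import Function.Base using (_∘′_)
open import Relation.Binary.Core using (Rel; REL; _Preserves_⟶_)
open import Relation.Binary.Construct.Closure.ReflexiveTransitive as Star
  using (Star; ε; _◅_; _◅◅_)
open import Relation.Binary.PropositionalEquality
  using (_≡_; _≢_; refl; sym; trans; cong; subst; subst₂)

private variable
  ℓ : Level
  B : Set ℓ
  k l : ℕ

-- Appending a last value to a finite sequence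

snoc : (Fin k → B) → B → Fin (suc k) → B
snoc {k = ℕ.zero} f b _       = b
snoc {k = suc k}  f b zero    = f zero
snoc {k = suc k}  f b (suc i) = snoc (λ j → f (suc j)) b i

snoc-fromℕ : ∀ k (f : Fin k → B) b → snoc f b (fromℕ k) ≡ b
snoc-fromℕ ℕ.zero  f b = refl
snoc-fromℕ (suc k) f b = snoc-fromℕ k (λ j → f (suc j)) b

snoc-inject≤ : (f : Fin k → B) (b : B) (i : Fin k) .(k≤1+k : k ℕ.≤ suc k) →
               snoc f b (inject≤ i k≤1+k) ≡ f i
snoc-inject≤ f b zero    _ = refl
snoc-inject≤ f b (suc i) p = snoc-inject≤ (λ j → f (suc j)) b i (ℕ.s≤s⁻¹ p)

-- The successive pairs of the extended sequence are those of `f` and the pair joining its last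
-- value to `b`.
snoc-successors : (P : Rel B ℓ) (f : Fin (suc k) → B) (b : B) →
                  (∀ i j → toℕ j ≡ suc (toℕ i) → P (f i) (f j)) → P (f (fromℕ k)) b →
                  ∀ i j → toℕ j ≡ suc (toℕ i) → P (snoc f b i) (snoc f b j)
snoc-successors {k = ℕ.zero} P f b step end zero       (suc zero)       eq = end
snoc-successors {k = suc k}  P f b step end zero       (suc zero)       eq =
  step zero (suc zero) refl
snoc-successors {k = suc k}  P f b step end (suc i)    (suc j)          eq =
  snoc-successors P (λ h → f (suc h)) b
    (λ h h′ eq′ → step (suc h) (suc h′) (cong suc eq′)) end i j (ℕ.suc-injective eq)

snoc-bounded : (f : Fin k → Fin (suc l)) {h : Fin (suc l)} → (∀ i → h Fin.≤ f i) →
               ∀ i → h Fin.≤ snoc f (fromℕ l) i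
snoc-bounded {k = ℕ.zero} f {h} bound _       = Fin.≤fromℕ h
snoc-bounded {k = suc k}  f     bound zero    = bound zero
snoc-bounded {k = suc k}  f     bound (suc i) =
  snoc-bounded (λ j → f (suc j)) (λ j → bound (suc j)) i

-- The appended value is the top of `Fin (suc l)`, so it lies above every value of `f`.
snoc-monotone : (f : Fin k → Fin (suc l)) → f Preserves Fin._≤_ ⟶ Fin._≤_ →
                snoc f (fromℕ l) Preserves Fin._≤_ ⟶ Fin._≤_
snoc-monotone {k = ℕ.zero} f mono _ = ℕ.≤-refl
snoc-monotone {k = suc k} f mono {zero} {zero} _ = ℕ.≤-refl
snoc-monotone {k = suc k} f mono {zero} {suc j} _ =
  snoc-bounded (λ i → f (suc i)) (λ i → mono ℕ.z≤n) j
snoc-monotone {k = suc k} f mono {suc i} {suc j} (ℕ.s≤s i≤j) =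
  snoc-monotone (λ h → f (suc h)) (λ h≤h′ → mono (ℕ.s≤s h≤h′)) i≤j

inject≤≗inject₁ : (i : Fin k) .(k≤1+k : k ℕ.≤ suc k) → inject≤ i k≤1+k ≡ inject₁ i
inject≤≗inject₁ i k≤1+k =
  Fin.toℕ-injective (trans (Fin.toℕ-inject≤ i k≤1+k) (sym (Fin.toℕ-inject₁ i)))

module _ {a} {A : Set a} {τ : A} where
  open WLTS A τ

  private variable
    x y r s ρ : Level
    X : LTS x r
    Y : LTS y s
    π π′ : Prefix
    m n m′ n′ : ℕ
    b : Visible
    u v w : V

  -- The proof stored in a `Visible` is irrelevant, but here it serves only to reach absurdity.
  value≢τ : (b : Visible) → value b ≢ τ
  value≢τ (_ , [ b≢τ ]) b≡τ = ⊥-elim-irr (b≢τ b≡τ)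

  -- Coordinates of states and morphisms of the free category

  coords-block≤ : (p : State (π , n)) → proj₂ (coords p) ℕ.≤ suc (blocks π)
  coords-block≤ (last i) = ℕ.≤-refl
  coords-block≤ (prev p) = ℕ.m≤n⇒m≤1+n (coords-block≤ p)

  last-block : (p : State (π , n)) → proj₂ (coords p) ≡ suc (blocks π) → ∃[ i ] p ≡ last i
  last-block (last i) eq = i , refl
  last-block (prev p) eq = ⊥-elim (ℕ.1+n≰n (subst (ℕ._≤ _) eq (coords-block≤ p)))

  -- The block number decides between `last` and `prev`, since states under `prev` lie in strictly
  -- earlier blocks; inside a block the position decides.
  coords-injective : (p q : State v) → coords p ≡ coords q → p ≡ q
  coords-injective (last i) q        eq with last-block q (sym (cong proj₂ eq))
  ... | j , refl = cong last (Fin.toℕ-injective (cong proj₁ eq))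
  coords-injective q@(prev _) (last j) eq with last-block q (cong proj₂ eq)
  ... | _ , ()
  coords-injective (prev p) (prev q) eq = cong prev (coords-injective p q eq)

  J𝔼-coords : (e : Free𝔼 v w) (p : State v) → coords (fun (J𝔼 e) p) ≡ coords p
  J𝔼-coords ε        p = refl
  J𝔼-coords (e ◅ es) p = trans (J𝔼-coords es _) (J-edge-coords e p)

  -- Both sides preserve coordinates. Hence a morphism may be traded for any other factorisation
  -- with the same endpoints.
  J𝔼-unique : (e e′ : Free𝔼 v w) → J𝔼 e ≈ J𝔼 e′
  J𝔼-unique e e′ p = coords-injective _ _ (trans (J𝔼-coords e p) (sym (J𝔼-coords e′ p)))

  J𝔼-◅◅ : (e : Free𝔼 u v) (e′ : Free𝔼 v w) → J𝔼 (e ◅◅ e′) ≈ J𝔼 e′ ∘ J𝔼 e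
  J𝔼-◅◅ ε        e′ p = refl
  J𝔼-◅◅ (e ◅ es) e′ p = J𝔼-◅◅ es e′ _

  -- The edges along which a simulation is built: one more τ-step, or one more
  -- letter. By J𝔼-unique their composites represent all morphisms of Free𝔼.
  data Generator : V → V → Set a where
    tick   : Generator (π , n) (π , suc n)
    letter : (b : Visible) → Generator (π , n) (π ▷ n · b , 0)

  edge : Generator v w → 𝔼 v w
  edge tick       = e-τ (ℕ.n≤1+n _)
  edge (letter b) = e-a ℕ.≤-refl b 0

  path : Star Generator v w → Free𝔼 v w
  path = Star.map edge

  -- The order `≤‴` recurses by raising its lower bound, just as a `Star` advances its source.
  ticks : n ℕ.≤‴ n′ → Star Generator (π , n) (π , n′)
  ticks ℕ.≤‴-refl     = ε
  ticks (ℕ.≤‴-step p) = tick ◅ ticks p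

  factor : Free𝔼 v w → Star Generator v w
  factor = Star.concat ∘′ Star.map factor-edge
    where
    factor-edge : 𝔼 v w → Star Generator v w
    factor-edge (e-τ n≤n′)     = ticks (ℕ.≤⇒≤‴ n≤n′)
    -- The current block is first filled up to `n′`; the letter opens a block with a single state,
    -- which then grows to `m`.
    factor-edge (e-a n≤n′ b m) = ticks (ℕ.≤⇒≤‴ n≤n′) ◅◅ letter b ◅ ticks (ℕ.≤⇒≤‴ ℕ.z≤n)

  -- Inclusions and surjections between shapes

  include-refl : (p : State (π , n)) → include ℕ.≤-refl p ≡ p
  include-refl (last i) = cong last (Fin.inject≤-refl i _)
  include-refl (prev p) = refl

  -- The added point goes to the top, so `f` has to hit only the other points.
  snoc-surjection : (f : Fin (suc m) → Fin (suc n)) → f Preserves Fin._≤_ ⟶ Fin._≤_ →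
                    (∀ j → (∃[ i ] f i ≡ j) ⊎ fromℕ n ≡ j) → MonotoneSurjection (suc m) n
  snoc-surjection {m} {n} f mono cover = record
    { to         = snoc f (fromℕ n)
    ; monotone   = snoc-monotone f mono
    ; surjective = λ j → hit (cover j)
    }
    where
    hit : ∀ {j} → (∃[ i ] f i ≡ j) ⊎ fromℕ n ≡ j →
          ∃[ i ] (∀ {h} → h ≡ i → snoc f (fromℕ n) h ≡ j)
    hit (inj₁ (i , fi≡j)) = inject≤ i (ℕ.n≤1+n _) ,
      λ { refl → trans (snoc-inject≤ f (fromℕ n) i _) fi≡j }
    hit (inj₂ top≡j)      = fromℕ (suc m) ,
      λ { refl → trans (snoc-fromℕ (suc m) f (fromℕ n)) top≡j }

  preimage : (σ : MonotoneSurjection m n) (j : Fin (suc n)) → ∃[ i ] to σ i ≡ j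
  preimage σ j = proj₁ (surjective σ j) , proj₂ (surjective σ j) refl

  -- For a position added on both sides: `inject₁` leaves exactly the new top uncovered, and the new
  -- position takes it.
  grow : MonotoneSurjection m n → MonotoneSurjection (suc m) (suc n)
  grow {m} {n} σ = snoc-surjection f mono cover
    where
    f : Fin (suc m) → Fin (suc (suc n))
    f i = inject₁ (to σ i)
    mono : f Preserves Fin._≤_ ⟶ Fin._≤_
    mono {i} {j} i≤j = subst₂ ℕ._≤_ (sym (Fin.toℕ-inject₁ (to σ i)))
                              (sym (Fin.toℕ-inject₁ (to σ j))) (monotone σ i≤j)
    cover : ∀ j → (∃[ i ] f i ≡ j) ⊎ fromℕ (suc n) ≡ j
    cover j with view j
    ... | ‵fromℕ     = inj₂ refl
    ... | ‵inject₁ h = inj₁ (proj₁ (preimage σ h) , cong inject₁ (proj₂ (preimage σ h)))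

  -- For a surplus position, which collapses onto the old top.
  stall : MonotoneSurjection m n → MonotoneSurjection (suc m) n
  stall σ = snoc-surjection (to σ) (monotone σ) λ j → inj₁ (preimage σ j)

  idσ : MonotoneSurjection n n
  idσ = record
    { to         = λ i → i
    ; monotone   = λ i≤j → i≤j
    ; surjective = λ j → j , λ i≡j → i≡j
    }

  id𝕊 : ∀ π → 𝕊 (π , n) (π , n)
  id𝕊 []          = [ idσ ]
  id𝕊 (π ▷ _ · _) = id𝕊 π ▷ idσ

  collapse-id : ∀ π (p : State (π , n)) → collapse (id𝕊 π) p ≡ p
  collapse-id []          (last i) = refl
  collapse-id (π ▷ _ · _) (last i) = refl
  collapse-id (π ▷ _ · _) (prev p) = cong prev (collapse-id π p)

  mapLast : (MonotoneSurjection m n → MonotoneSurjection m′ n′) →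
            𝕊 (π , m) (π′ , n) → 𝕊 (π , m′) (π′ , n′)
  mapLast F [ σ ]   = [ F σ ]
  mapLast F (s ▷ σ) = s ▷ F σ

  -- `comm` is the square on the last block; on earlier blocks both inclusions are the identity.
  mapLast-include : (F : MonotoneSurjection m n → MonotoneSurjection m′ n′)
                    (m≤m′ : m ℕ.≤ m′) (n≤n′ : n ℕ.≤ n′) →
                    (∀ σ i → inject≤ (to σ i) (ℕ.s≤s n≤n′) ≡ to (F σ) (inject≤ i (ℕ.s≤s m≤m′))) →
                    (s : 𝕊 (π , m) (π′ , n)) (p : State (π , m)) →
                    include n≤n′ (collapse s p) ≡ collapse (mapLast F s) (include m≤m′ p)
  mapLast-include F m≤m′ n≤n′ comm [ σ ]   (last i) = cong last (comm σ i)
  mapLast-include F m≤m′ n≤n′ comm (s ▷ σ) (last i) = cong last (comm σ i)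
  mapLast-include F m≤m′ n≤n′ comm (s ▷ σ) (prev p) = refl

  grow-include : (s : 𝕊 (π , m) (π′ , n)) (p : State (π , m)) →
                 include (ℕ.n≤1+n n) (collapse s p) ≡
                 collapse (mapLast grow s) (include (ℕ.n≤1+n m) p)
  grow-include = mapLast-include grow _ _ λ σ i →
    trans (inject≤≗inject₁ (to σ i) _) (sym (snoc-inject≤ _ _ i _))

  stall-include : (s : 𝕊 (π , m) (π′ , n)) (p : State (π , m)) →
                  collapse s p ≡ collapse (mapLast stall s) (include (ℕ.n≤1+n m) p)
  -- The target shape does not grow, so its inclusion is the one along `ℕ.≤-refl`.
  stall-include s p = trans (sym (include-refl (collapse s p)))
    (mapLast-include stall _ ℕ.≤-refl
      (λ σ i → trans (Fin.inject≤-refl (to σ i) _) (sym (snoc-inject≤ _ _ i _))) s p)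

  -- Extending a path by a τ-step or a letter

  TauOrIdle : (X : LTS x r) → Carrier X → Carrier X → Set (x ⊔ r)
  TauOrIdle X p q = LTS._⟶[_]_ X p τ q ⊎ p ≡ q

  fun-τ : (f : Hom (J v) X) {p q : State v} → Step p τ q → TauOrIdle X (fun f p) (fun f q)
  fun-τ f step with fun-trans f step
  ... | inj₁ step′      = inj₁ step′
  ... | inj₂ (_ , fp≡fq) = inj₂ fp≡fq

  fun-visible : (f : Hom (J v) X) (b : Visible) {p q : State v} → Step p (value b) q →
                LTS._⟶[_]_ X (fun f p) (value b) (fun f q)
  fun-visible f b step with fun-trans f step
  ... | inj₁ step′      = step′
  ... | inj₂ (b≡τ , _) = ⊥-elim (value≢τ b b≡τ)

  module _ {Y : LTS y r} where
    open LTS Y using (_⟶[_]_)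

    -- Allowing `q` to be the old end makes idle positions available, as `lift-tick` requires.
    extend-τ : (g : Hom (J (π , n)) Y) (q : Carrier Y) → TauOrIdle Y (end g) q →
               Hom (J (π , suc n)) Y
    extend-τ {π} {n} g q step = record
      { fun = g′ ; fun-init = trans (g′-first π g) (fun-init g) ; fun-trans = pres }
      where
      on : ∀ {π} → (State (π , n) → Carrier Y) → State (π , suc n) → Carrier Y
      on h (last i) = snoc (λ j → h (last j)) q i
      on h (prev p) = h (prev p)
      g′ = on (fun g)
      g′-first : ∀ π (g : Hom (J (π , n)) Y) → on (fun g) (first π (suc n)) ≡ fun g (first π n)
      g′-first []          g = refl
      g′-first (_ ▷ _ · _) g = refl
      τ-pres : ∀ i j → toℕ j ≡ suc (toℕ i) → TauOrIdle Y (g′ (last i)) (g′ (last j))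
      τ-pres = snoc-successors (TauOrIdle Y) (λ j → fun g (last j)) q
                 (λ i j eq → fun-τ g (τ-step eq)) step
      pres : ∀ {p c q} → Step p c q → (g′ p ⟶[ c ] g′ q) ⊎ (c ≡ τ × g′ p ≡ g′ q)
      pres (τ-step {i = i} {j} eq) with τ-pres i j eq
      ... | inj₁ step′ = inj₁ step′
      ... | inj₂ idle  = inj₂ (refl , idle)
      pres a-step      = fun-trans g a-step
      pres (prev st)   = fun-trans g (prev st)

    extend-τ-include : (g : Hom (J (π , n)) Y) (q : Carrier Y)
                       (step : TauOrIdle Y (end g) q) →
                       g ≈ extend-τ g q step ∘ J-edge (e-τ (ℕ.n≤1+n n))
    extend-τ-include g q step (last i) = sym (snoc-inject≤ (λ j → fun g (last j)) q i _)
    extend-τ-include g q step (prev p) = refl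

    end-extend-τ : (g : Hom (J (π , n)) Y) (q : Carrier Y)
                   (step : TauOrIdle Y (end g) q) →
                   end (extend-τ g q step) ≡ q
    end-extend-τ {n = n} g q step = snoc-fromℕ (suc n) (λ j → fun g (last j)) q

    extend-letter : (g : Hom (J (π , n)) Y) (b : Visible) (q : Carrier Y) →
                    end g ⟶[ value b ] q → Hom (J (π ▷ n · b , 0)) Y
    extend-letter {π} {n} g b q step = record
      { fun = g′ ; fun-init = fun-init g ; fun-trans = pres }
      where
      g′ : State (π ▷ n · b , 0) → Carrier Y
      g′ (last _) = q
      g′ (prev p) = fun g p
      pres : ∀ {p c q} → Step p c q → (g′ p ⟶[ c ] g′ q) ⊎ (c ≡ τ × g′ p ≡ g′ q)
      -- The new block has one state and hence no τ-step; since `g′` is constant there, the idle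
      -- answer typechecks without a refutation.
      pres (τ-step _) = inj₂ (refl , refl)
      pres a-step     = inj₁ step
      pres (prev st)  = fun-trans g st

    extend-letter-include : (g : Hom (J (π , n)) Y) (b : Visible) (q : Carrier Y)
                            (step : end g ⟶[ value b ] q) →
                            g ≈ extend-letter g b q step ∘ J-edge (e-a ℕ.≤-refl b 0)
    extend-letter-include g b q step p = cong (fun g) (sym (include-refl p))

    -- One stage of answering the extension `e` in `Y`. The surjection `s` records how the shape `u`
    -- of the path in `Y` is already stretched over `v`; with `s` arbitrary, the `shrink` of one
    -- stage can be the `s` of the next.
    record Lift (s : 𝕊 u v) (e : Free𝔼 v w) (g : Hom (J u) Y) (q : Carrier Y) :
                Set (a ⊔ y ⊔ r) where
      field
        {shape} : V
        lifted  : Free𝔼 u shape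
        shrink  : 𝕊 shape w
        map     : Hom (J shape) Y
        square  : J𝔼 e ∘ J𝕊 s ≈ J𝕊 shrink ∘ J𝔼 lifted
        extends : g ≈ map ∘ J𝔼 lifted
        ends    : end map ≡ q

    open Lift

    stay : (s : 𝕊 u v) (g : Hom (J u) Y) → Lift s ε g (end g)
    stay s g = record
      { lifted = ε ; shrink = s ; map = g
      ; square = λ _ → refl ; extends = λ _ → refl ; ends = refl }

    infixr 5 _then_
    -- The two squares are pasted; `J𝔼-◅◅` splits the composite extensions.
    _then_ : {s : 𝕊 u v} {e : Free𝔼 v w} {w′ : V} {e′ : Free𝔼 w w′} {g : Hom (J u) Y}
             {p q : Carrier Y} →
             (L : Lift s e g p) → Lift (shrink L) e′ (map L) q → Lift s (e ◅◅ e′) g q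
    _then_ {s = s} {e = e} {e′ = e′} L M = record
      { lifted  = lifted L ◅◅ lifted M
      ; shrink  = shrink M
      ; map     = map M
      ; square  = λ p →
          trans (J𝔼-◅◅ e e′ (collapse s p))
          (trans (cong (fun (J𝔼 e′)) (square L p))
          (trans (square M (fun (J𝔼 (lifted L)) p))
          (cong (collapse (shrink M)) (sym (J𝔼-◅◅ (lifted L) (lifted M) p)))))
      ; extends = λ p →
          trans (extends L p)
          (trans (extends M (fun (J𝔼 (lifted L)) p))
          (cong (fun (map M)) (sym (J𝔼-◅◅ (lifted L) (lifted M) p))))
      ; ends    = ends M
      }

    lift-tick : (s : 𝕊 (π , m) (π′ , n)) (g : Hom (J (π , m)) Y) →
                Lift s (path (tick ◅ ε)) g (end g)
    lift-tick s g = record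
      { lifted  = path (tick ◅ ε)
      ; shrink  = mapLast grow s
      ; map     = extend-τ g (end g) (inj₂ refl)
      ; square  = grow-include s
      ; extends = extend-τ-include g (end g) (inj₂ refl)
      ; ends    = end-extend-τ g (end g) (inj₂ refl)
      }

    lift-stall : (s : 𝕊 (π , m) (π′ , n)) (g : Hom (J (π , m)) Y) {q : Carrier Y} →
                 end g ⟶[ τ ] q → Lift s ε g q
    lift-stall s g {q} step = record
      { lifted  = path (tick ◅ ε)
      ; shrink  = mapLast stall s
      ; map     = extend-τ g q (inj₁ step)
      ; square  = stall-include s
      ; extends = extend-τ-include g q (inj₁ step)
      ; ends    = end-extend-τ g q (inj₁ step)
      }

    lift-letter : (s : 𝕊 (π , m) (π′ , n)) (g : Hom (J (π , m)) Y) {q : Carrier Y} →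
                  end g ⟶[ value b ] q → Lift s (path (letter b ◅ ε)) g q
    lift-letter {b = b} s g {q} step = record
      { lifted  = path (letter b ◅ ε)
      ; shrink  = s ▷ idσ
      ; map     = extend-letter g b q step
      ; square  = λ p → cong prev (trans (include-refl (collapse s p))
                                         (cong (collapse s) (sym (include-refl p))))
      ; extends = extend-letter-include g b q step
      ; ends    = refl
      }

    -- Every silent step is a stall, so the target shape stays fixed. The start is given up to
    -- `end g ≡ p` because a previous lift knows its end only through an equation.
    lift-silent : (s : 𝕊 u v) (g : Hom (J u) Y) {p q : Carrier Y} → end g ≡ p →
                  Silent Y p q → Lift s ε g q
    lift-silent s g refl ε              = stay s g
    lift-silent s g refl (step ◅ steps) =
      L then lift-silent (shrink L) (map L) (ends L) steps
      where L = lift-stall s g step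

    lift-weak : (s : 𝕊 (π , m) (π′ , n)) (g : Hom (J (π , m)) Y) {p q : Carrier Y} → end g ≡ p →
                Weak Y (value b) p q → Lift s (path (letter b ◅ ε)) g q
    lift-weak {b = b} s g end≡p (p′ , q′ , before , step , after) =
      -- Silent steps before the letter stall in the old last block, those after it in the block
      -- that the letter opens.
      L then M then lift-silent (shrink M) (map M) (ends M) after
      where
      L = lift-silent s g end≡p before
      M = lift-letter {b = b} (shrink L) (map L) (subst (_⟶[ value b ] q′) (sym (ends L)) step)

  open Lift

  -- From weak transfer to path simulation

  step-end : (f : Hom (J (π , suc n)) X) →
             TauOrIdle X (fun f (include (ℕ.n≤1+n n) (final (π , n)))) (end f)
  step-end {n = n} f = fun-τ f (τ-step (cong suc
    (sym (Fin.toℕ-inject≤ (fromℕ n) (ℕ.s≤s (ℕ.n≤1+n n))))))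

  step-letter : (f : Hom (J (π ▷ n · b , 0)) X) →
                LTS._⟶[_]_ X (fun f (prev (include ℕ.≤-refl (final (π , n))))) (value b) (end f)
  step-letter {n = n} {b = b} {X = X} f =
    subst (λ p → LTS._⟶[_]_ X (fun f (prev p)) (value b) (end f))
          (sym (include-refl (final _))) (fun-visible f b a-step)

  module _ {X : LTS x r} {Y : LTS y s} {R : REL (Carrier X) (Carrier Y) ρ}
           (transfer : WeakTransfer X Y R) where
    open WeakTransfer transfer

    simulate-generator :
      (s : 𝕊 u v) (g : Hom (J u) Y) (e : Generator v w) (f : Hom (J w) X) →
      R (fun f (fun (J-edge (edge e)) (final v))) (end g) →
      ∃[ q ] R (end f) q × Lift s (path (e ◅ ε)) g q
    simulate-generator s g tick f fRg with step-end f
    -- The path in `X` idles at the new position, so the path in `Y` idles as well.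
    ... | inj₂ idle = end g , subst (λ p → R p (end g)) idle fRg , lift-tick s g
    ... | inj₁ step with silent fRg step
    ...   | q , fRq , steps =
      -- The idle tick comes first: it creates the new top onto which the silent steps are then
      -- collapsed.
      q , fRq , (L then lift-silent (shrink L) (map L) (ends L) steps)
      where L = lift-tick s g
    simulate-generator s g (letter b) f fRg
      with visible fRg (value≢τ b) (step-letter f)
    ... | q , fRq , weak = q , fRq , lift-weak s g refl weak

    -- Induction along the generators; each one is answered for `f` restricted to the shape that it
    -- reaches.
    simulate :
      (s : 𝕊 u v) (g : Hom (J u) Y) (es : Star Generator v w) (f : Hom (J w) X) →
      R (fun f (fun (J𝔼 (path es)) (final v))) (end g) →
      ∃[ q ] R (end f) q × Lift s (path es) g q
    simulate s g ε        f fRg = end g , fRg , stay s g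
    simulate s g (e ◅ es) f fRg
      with simulate-generator s g e (f ∘ J𝔼 (path es)) fRg
    ... | p , fRp , L
      with simulate (shrink L) (map L) es f (subst (R _) (sym (ends L)) fRp)
    ...   | q , fRq , M = q , fRq , (L then M)

    toSpans-simulation : R (init X) (init Y) → IsPathSimulation X Y (toSpans X Y R)
    toSpans-simulation iRi = record { initial = iRi ; forward = λ {_} {_} {f} {g} → forward f g }
      where
      forward : ∀ {v w} (f : Hom (J v) X) (g : Hom (J v) Y) → R (end f) (end g) →
                (e : Free𝔼 v w) (f′ : Hom (J w) X) → f ≈ f′ ∘ J𝔼 e →
                ∃[ u ] Σ[ e′ ∈ Free𝔼 v u ] Σ[ s ∈ 𝕊 u w ] Σ[ g′ ∈ Hom (J u) Y ]
                  J𝔼 e ≈ J𝕊 s ∘ J𝔼 e′ × g ≈ g′ ∘ J𝔼 e′ × R (end (f′ ∘ J𝕊 s)) (end g′)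
      -- The lift starts from the identity surjection, and `J𝔼-unique` replaces `e` by its
      -- factorisation into generators.
      forward {v} f g fRg e f′ f≈ with simulate (id𝕊 (proj₁ v)) g (factor e) f′
        (subst (λ p → R p (end g))
               (trans (f≈ (final v))
                      (cong (fun f′) (J𝔼-unique e (path (factor e)) (final v)))) fRg)
      ... | q , f′Rq , L =
        shape L , lifted L , shrink L , map L ,
        (λ p → trans (J𝔼-unique e (path (factor e)) p)
               (trans (cong (fun (J𝔼 (path (factor e)))) (sym (collapse-id (proj₁ v) p)))
                      (square L p))) ,
        extends L ,
        -- Surjections send final states to final states, so `f′ ∘ J𝕊 s` ends where `f′` does.
        subst₂ R (cong (fun f′) (sym (collapse-final (shrink L)))) (sym (ends L)) f′Rq

  -- From path simulation to weak transfer

  𝕊-blocks : 𝕊 (π , m) (π′ , n) → blocks π ≡ blocks π′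
  𝕊-blocks [ _ ]   = refl
  𝕊-blocks (s ▷ _) = cong suc (𝕊-blocks s)

  idle-or-silent : ∀ {p q} → TauOrIdle X p q → Silent X p q
  idle-or-silent (inj₁ step) = step ◅ ε
  idle-or-silent (inj₂ refl) = ε

  -- Going up through the positions, real steps are kept and idle ones dropped.
  silent-to-top : (h : Fin (suc n) → Carrier X) →
                  (∀ i j → toℕ j ≡ suc (toℕ i) → TauOrIdle X (h i) (h j)) →
                  ∀ i → Silent X (h i) (h (fromℕ n))
  silent-to-top {n = ℕ.zero} h step zero    = ε
  silent-to-top {n = suc n}  {X = X} h step zero    =
    idle-or-silent {X = X} (step zero (suc zero) refl) ◅◅
    silent-to-top {X = X} (λ i → h (suc i)) (λ i j eq → step (suc i) (suc j) (cong suc eq)) zero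
  silent-to-top {n = suc n}  {X = X} h step (suc i) =
    silent-to-top {X = X} (λ i → h (suc i)) (λ i j eq → step (suc i) (suc j) (cong suc eq)) i

  silent-block : (f : Hom (J (π , n)) X) (i : Fin (suc n)) → Silent X (fun f (last i)) (end f)
  silent-block {X = X} f =
    silent-to-top {X = X} (λ i → fun f (last i)) (λ i j eq → fun-τ f (τ-step eq))

  silent-prev : (f : Hom (J (π ▷ m · b , n)) X) (i : Fin (suc m)) →
                Silent X (fun f (prev (last i))) (fun f (prev (final (π , m))))
  silent-prev {X = X} f =
    silent-to-top {X = X} (λ i → fun f (prev (last i))) (λ i j eq → fun-τ f (prev (τ-step eq)))

  J𝔼-final-block : (e : Free𝔼 (π , n) w) →
                   proj₂ (coords (fun (J𝔼 e) (final (π , n)))) ≡ suc (blocks π)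
  J𝔼-final-block e = cong proj₂ (J𝔼-coords e (final _))

  -- By `𝕊-blocks` the image under `e` of the final state lies in the last block of `u`, where only
  -- τ-positions remain.
  silent-extension : (g : Hom (J (π , n)) X) (e : Free𝔼 (π , n) u) (s : 𝕊 u (π , n′))
                     (g′ : Hom (J u) X) → g ≈ g′ ∘ J𝔼 e → Silent X (end g) (end g′)
  silent-extension {π = π} {n = n} {X = X} {u = _ , _} g e s g′ g≈
    with last-block (fun (J𝔼 e) (final (π , n)))
                    (trans (J𝔼-final-block e) (cong suc (sym (𝕊-blocks s))))
  ... | i , eq = subst (λ p → Silent X p (end g′)) (sym (trans (g≈ _) (cong (fun g′) eq)))
                       (silent-block g′ i)

  penultimate-block : (p : State (π ▷ m · b , n)) → proj₂ (coords p) ≡ suc (blocks π) →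
                      ∃[ i ] p ≡ prev (last i)
  penultimate-block (last i) eq = ⊥-elim (ℕ.1+n≢n eq)
  penultimate-block (prev p) eq with last-block p eq
  ... | i , refl = i , refl

  -- The constructor `s ▷ σ` exposes the last letter of `u` as the same `b`, so crossing it along
  -- `g′` is the visible transition sought.
  weak-extension : (g : Hom (J (π , n)) X) (e : Free𝔼 (π , n) u) (s : 𝕊 u (π ▷ m · b , n′))
                   (g′ : Hom (J u) X) → g ≈ g′ ∘ J𝔼 e → Weak X (value b) (end g) (end g′)
  weak-extension {π = π} {n = n} {X = X} {b = b} g e (s ▷ σ) g′ g≈
    with penultimate-block (fun (J𝔼 e) (final (π , n)))
                           (trans (J𝔼-final-block e) (cong suc (sym (𝕊-blocks s))))
  ... | i , eq =
    fun g′ (prev (final _)) , fun g′ (last zero) ,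
    subst (λ p → Silent X p (fun g′ (prev (final _)))) (sym (trans (g≈ _) (cong (fun g′) eq)))
          (silent-prev g′ i) ,
    fun-visible g′ b a-step ,
    silent-block g′ zero

  module _ {X : LTS x r} {Y : LTS y s} {S : SpanSet X Y ρ} (sim : IsPathSimulation X Y S) where
    open IsPathSimulation sim

    fromSpans-transfer : WeakTransfer X Y (fromSpans X Y S)
    fromSpans-transfer = record { silent = silent′ ; visible = visible′ }
      where
      silent′ : ∀ {p q p′} → fromSpans X Y S p q → LTS._⟶[_]_ X p τ p′ →
                ∃[ q′ ] fromSpans X Y S p′ q′ × Silent Y q q′
      silent′ {p′ = p′} ((π , n) , f , g , fSg , refl , refl) step
        -- The transition to `p′` becomes an extension of `f` by one generator, which the path
        -- simulation answers.
        with forward fSg (path (tick ◅ ε)) (extend-τ f p′ (inj₁ step))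
                     (extend-τ-include f p′ (inj₁ step))
      ... | u , e′ , s , g′ , _ , g≈ , f′Sg′ =
        end g′ ,
        (u , f′ ∘ J𝕊 s , g′ , f′Sg′ ,
         trans (sym (end-extend-τ f p′ (inj₁ step)))
           (cong (fun f′) (sym (collapse-final s))) , refl) ,
        silent-extension g e′ s g′ g≈
        where f′ = extend-τ f p′ (inj₁ step)
      visible′ : ∀ {p q c p′} → fromSpans X Y S p q → c ≢ τ → LTS._⟶[_]_ X p c p′ →
                 ∃[ q′ ] fromSpans X Y S p′ q′ × Weak Y c q q′
      visible′ {c = c} {p′} ((π , n) , f , g , fSg , refl , refl) c≢τ step
        with forward fSg (path (letter (c , [ c≢τ ]) ◅ ε)) (extend-letter f (c , [ c≢τ ]) p′ step)
                     (extend-letter-include f (c , [ c≢τ ]) p′ step)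
      ... | u , e′ , s , g′ , _ , g≈ , f′Sg′ =
        end g′ ,
        (u , f′ ∘ J𝕊 s , g′ , f′Sg′ , cong (fun f′) (sym (collapse-final s)) , refl) ,
        weak-extension g e′ s g′ g≈
        where f′ = extend-letter f (c , [ c≢τ ]) p′ step

  -- Reversal and the two bisimulation statements

  WeakTransfer-resp : {R R′ : REL (Carrier X) (Carrier Y) ρ} →
                      (∀ {p q} → R′ p q → R p q) → (∀ {p q} → R p q → R′ p q) →
                      WeakTransfer X Y R → WeakTransfer X Y R′
  WeakTransfer-resp to from transfer = record
    { silent  = λ pR′q step → let q′ , p′Rq′ , w = silent (to pR′q) step in q′ , from p′Rq′ , w
    ; visible = λ pR′q b≢τ step →
        let q′ , p′Rq′ , w = visible (to pR′q) b≢τ step in q′ , from p′Rq′ , w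
    }
    where open WeakTransfer transfer

  -- As `S † †` is `S` by eta, the instance at `S †` gives the converse.
  fromSpans-† : (S : SpanSet X Y ρ) → ∀ {p q} →
                fromSpans X Y S p q → fromSpans Y X (S †) q p
  fromSpans-† S (v , f , g , fSg , p≡ , q≡) = v , g , f , fSg , q≡ , p≡

  toSpans-bisimulation : {R : REL (Carrier X) (Carrier Y) ρ} →
                         IsWeakBisimulation X Y R → IsPathBisimulation X Y (toSpans X Y R)
  toSpans-bisimulation bisim = record
    { forth = toSpans-simulation forth initial
    -- Reversing the spans of `R` and taking the spans of its converse give the same `Span` but
    -- different `resp` terms, so the simulation is repacked field by field.
    ; back  = record
        { initial = P.initial ; forward = λ {_} {_} {f} {g} → P.forward {f = f} {g = g} }
    }
    where
    open IsWeakBisimulation bisim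
    module P = IsPathSimulation (toSpans-simulation back initial)

  fromSpans-bisimulation : (S : SpanSet X Y ρ) → IsPathBisimulation X Y S →
                           IsWeakBisimulation X Y (fromSpans X Y S)
  fromSpans-bisimulation S bisim = record
    { initial = 𝟎 , ¡ , ¡ , IsPathSimulation.initial forth , refl , refl
    ; forth   = fromSpans-transfer forth
    ; back    = WeakTransfer-resp (fromSpans-† S) (fromSpans-† (S †))
                                  (fromSpans-transfer back)
    }
    where
    open IsPathBisimulation bisim

theorem6p9 : ∀ {a x r y s ρ} (A : Set a) (τ : A) →
    let open WLTS A τ in
    (X : LTS x r) (Y : LTS y s) →
    ((R : REL (Carrier X) (Carrier Y) ρ) →
    IsWeakBisimulation X Y R → IsPathBisimulation X Y (toSpans X Y R)) ×
    ((R : SpanSet X Y ρ) →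
    IsPathBisimulation X Y R → IsWeakBisimulation X Y (fromSpans X Y R))
theorem6p9 A τ X Y = (λ R → toSpans-bisimulation) , fromSpans-bisimulation
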